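{- Let $S$ be any set of deterministic gadgets. Then any system consisting of multiple copies of gadgets in $S$ together with a spawner (and optionally a destroyer), in the 1-player multi-robot motion planning model, can be simulated by a Petri net.
   Context: A gadget consists of a finite set of locations and a finite set of states, together with a transition graph: a directed graph on (state, location) pairs, where an edge from $(Q,a)$ to $(Q',b)$ means that a robot can enter the gadget at $a$ when the gadget is in state $Q$, exit at $b$, and thereby change the gadget's state to $Q'$. A gadget is deterministic if its transition graph has maximum out-degree 1. A system of gadgets consists of finitely many gadgets, their initial states, and an (undirected) connection graph on their locations; locations joined by a path in the connection graph are identified, and robots move freely between them. 1-player multi-robot motion planning: a single player controls a set of robots, moving any one robot at a time (through the connection graph and through gadget transitions); any number of robots may be at a location. A spawner is a 1-location gadget (the source) at whose location the player may produce new robots at any time without limit. A destroyer is a 1-location gadget (the sink) that deletes any robot reaching its location. A configuration of a system $G$ is a pair $(\Gamma,l)$, where $\Gamma$ gives the states of all gadgets and $l$ is the vector of numbers of robots at each location; $REACH_G(\Gamma,l)$ is the set of configurations reachable from $(\Gamma,l)$. A Petri net $\{D,R\}$ consists of a finite set $D$ of dishes and a finite set $R$ of rules. A configuration is a vector of nonnegative integers indexed by $D$ (numbers of tokens). A rule is a pair $(u,v)$ of nonnegative integer vectors over $D$; it can be applied to configuration $d_0$ if $d_0-u$ has no negative entries, yielding $d_0-u+v$. $REACH_P(\{D,R\},t)$ is the set of configurations reachable from $t$ by applying rules from $R$. Representation: $D=D_{STATE}\cup D_{LOCT}$. Each $k$-state gadget (other than the spawner and destroyer) has $k$ unique dishes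 in $D_{STATE}$, one per state, and each location other than the source and the sink has a unique dish in $D_{LOCT}$. A Petri net configuration $t$ represents $(\Gamma,l)$ if, for each gadget, the dish of its current state contains exactly one token and its other state dishes are empty, and the number of tokens in each location dish equals the number of robots at that location. (Robots at the source are not represented.) Simulation: the Petri net $\{D,R\}$ simulates the system $G$ if, for every configuration $(\Gamma,l)$ of $G$ represented by a Petri net configuration $t$, each configuration in $REACH_G(\Gamma,l)$ is represented by a configuration in $REACH_P(\{D,R\},t)$, and each configuration in $REACH_P(\{D,R\},t)$ represents a configuration in $REACH_G(\Gamma,l)$. -}

module Defs where

open import Data.Bool.Base using (Bool; T)
open import Data.Fin.Base using (Fin)
open import Data.List.Base using (List; length; filterᵇ; cartesianProduct; allFin)
open import Data.List.Membership.Propositional using (_∈_)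
open import Data.Nat.Base using (ℕ; suc; _+_; _∸_; _≤_)
open import Data.Product.Base using (Σ; ∃; _×_; _,_; proj₁; proj₂)
open import Data.Sum.Base using (inj₁; inj₂)
open import Data.Sum.Relation.Binary.Pointwise using (_⊎ₛ_)
open import Data.Vec.Base using (Vec; lookup; zipWith)
open import Data.Vec.Relation.Binary.Pointwise.Inductive using (Pointwise)
open import Function.Bundles using (Func; Bijection; _⟨$⟩_)
open import Level using (0ℓ)
open import Relation.Binary.Bundles using (Setoid)
open import Relation.Binary.Construct.Closure.ReflexiveTransitive
  using (Star; ε; _◅◅_; reverse)
import Relation.Binary.Construct.On as On
open import Relation.Binary.PropositionalEquality using (_≡_; _≢_; setoid)
open import Relation.Nullary.Negation using (¬_)
open import Relation.Unary using (Pred)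

record Gadget : Set where
  field
    #states    : ℕ
    #locations : ℕ

  Vertex : Set
  Vertex = Fin #states × Fin #locations

  field
    -- Adjacency matrix of the transition graph.
    edge : Vertex → Vertex → Bool

  vertices : List Vertex
  vertices = cartesianProduct (allFin #states) (allFin #locations)

  outDegree : Vertex → ℕ
  outDegree v = length (filterᵇ (edge v) vertices)

open Gadget

Deterministic : Gadget → Set
Deterministic g = ∀ v → outDegree g v ≤ 1

-- The gadget locations of a system before any identification.  There is always
-- one spawner; its only location is `source`.  The destroyer is optional, and
-- its only location `sink` exists only if the destroyer does.
data Port {n : ℕ} (gadget : Fin n → Gadget) (destroyer : Bool) : Set where
  source : Port gadget destroyer
  sink   : T destroyer → Port gadget destroyer
  at     : (i : Fin n) → Fin (#locations (gadget i)) → Port gadget destroyer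

-- `gadget` lists the gadgets other than the spawner and the destroyer.
record System : Set where
  field
    #gadgets  : ℕ
    gadget    : Fin #gadgets → Gadget
    initial   : (i : Fin #gadgets) → Fin (#states (gadget i))
    destroyer : Bool
    connected : Port gadget destroyer → Port gadget destroyer → Bool
    symmetric : ∀ {p q} → T (connected p q) → T (connected q p)

ConsistsOf : ∀ {ℓ} → Pred Gadget ℓ → System → Set ℓ
ConsistsOf S G = ∀ i → S (System.gadget G i)

module _ (G : System) where
  open System G

  private
    P : Set
    P = Port gadget destroyer

  infix 4 _~_
  _~_ : P → P → Set
  _~_ = Star (λ p q → T (connected p q))

  -- The locations of the system: ports joined by a path are identified.
  Location : Setoid 0ℓ 0ℓ
  Location = record
    { Carrier       = P
    ; _≈_           = _~_
    ; isEquivalence = record { refl = ε ; sym = reverse symmetric ; trans = _◅◅_ }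
    }

  AtSource : P → Set
  AtSource p = p ~ source

  AtSink : P → Set
  AtSink p = Σ (T destroyer) λ d → p ~ sink d

  -- Functions respecting _~_, that is, vectors indexed by identified locations.
  Robots : Set
  Robots = Func Location (setoid ℕ)

  record Configuration : Set where
    field
      Γ          : (i : Fin #gadgets) → Fin (#states (gadget i))
      l          : Robots
      -- Robots reaching the sink are deleted, so none is ever there.
      sink-empty : ∀ {p} → AtSink p → l ⟨$⟩ p ≡ 0

  open Configuration

  -- l′ is l with one more robot at the location of p.
  record OneMore (p : P) (l l′ : Robots) : Set where
    field
      here      : ∀ {q} → q ~ p → l′ ⟨$⟩ q ≡ suc (l ⟨$⟩ q)
      elsewhere : ∀ {q} → ¬ q ~ p → l′ ⟨$⟩ q ≡ l ⟨$⟩ q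

  -- l′ results from l when a further robot, not counted in l, reaches p.
  data Arrives (p : P) (l l′ : Robots) : Set where
    stays   : ¬ AtSink p → OneMore p l l′ → Arrives p l l′
    deleted : AtSink p → (∀ q → l′ ⟨$⟩ q ≡ l ⟨$⟩ q) → Arrives p l l′

  -- Motion through the connection graph stays within one identified location,
  -- so it does not change the configuration and needs no constructor.
  data Step (c c′ : Configuration) : Set where
    spawn : (∀ i → Γ c′ i ≡ Γ c i) → Arrives source (l c) (l c′) → Step c c′

    -- `rest` counts the robots other than the one that moves.
    traverse : ∀ i a b (rest : Robots) →
      T (edge (gadget i) (Γ c i , a) (Γ c′ i , b)) →
      (∀ j → j ≢ i → Γ c′ j ≡ Γ c j) →
      OneMore (at i a) rest (l c) →
      Arrives (at i b) rest (l c′) →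
      Step c c′

  REACH-G : Configuration → Pred Configuration 0ℓ
  REACH-G = Star Step

-- The dishes are the elements of Fin #dishes.
record PetriNet : Set where
  field
    #dishes : ℕ

  Tokens : Set
  Tokens = Vec ℕ #dishes

  field
    rules : List (Tokens × Tokens)

  data Fires (d₀ : Tokens) : Tokens → Set where
    fire : ∀ {u v} → (u , v) ∈ rules → Pointwise _≤_ u d₀ →
           Fires d₀ (zipWith _+_ (zipWith _∸_ d₀ u) v)

  REACH-P : Tokens → Pred Tokens 0ℓ
  REACH-P = Star Fires

module _ (G : System) where
  open System G
  open Configuration

  D-STATE : Setoid 0ℓ 0ℓ
  D-STATE = setoid (Σ (Fin #gadgets) λ i → Fin (#states (gadget i)))

  -- The identified locations other than the source and the sink.
  D-LOCT : Setoid 0ℓ 0ℓ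
  D-LOCT = On.setoid
    {B = Σ (Port gadget destroyer) λ p → ¬ AtSource G p × ¬ AtSink G p}
    (Location G) proj₁

  -- A net with D = D-STATE ∪ D-LOCT: every state and every identified location
  -- has its own dish, and there are no other dishes.
  DishAssignment : PetriNet → Set
  DishAssignment N = Bijection (D-STATE ⊎ₛ D-LOCT) (setoid (Fin (PetriNet.#dishes N)))

  module _ (N : PetriNet) (dish : DishAssignment N) where
    open PetriNet N
    open Bijection dish using (to)

    record Represents (t : Tokens) (c : Configuration G) : Set where
      field
        current  : ∀ i → lookup t (to (inj₁ (i , Γ c i))) ≡ 1
        others   : ∀ i Q → Q ≢ Γ c i → lookup t (to (inj₁ (i , Q))) ≡ 0
        location : ∀ x → lookup t (to (inj₂ x)) ≡ l c ⟨$⟩ proj₁ x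

    record SimulatesVia : Set where
      field
        complete : ∀ c t → Represents t c →
          ∀ c′ → REACH-G G c c′ → ∃ λ t′ → REACH-P t t′ × Represents t′ c′
        sound : ∀ c t → Represents t c →
          ∀ t′ → REACH-P t t′ → ∃ λ c′ → REACH-G G c c′ × Represents t′ c′

Simulates : PetriNet → System → Set
Simulates N G = Σ (DishAssignment G N) (SimulatesVia G N)

{-# OPTIONS --safe #-}
module Submission where

-- Each transition (Q , a) → (Q′ , b) of gadget i becomes the rule that consumes a
-- token from the dish of Q and one from the dish of a, and produces one in the dish
-- of Q′ and one in the dish of b, where a location at the source or the sink
-- contributes no token.  Transitions leaving the sink get no rule.  A rule with a at
-- the source is matched by spawning a robot and then moving it, while a spawn alone
-- is invisible to the net.  Giving each identified location a single dish
-- requires connectivity to be decidable.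

open import Defs
open import Data.Bool.Base using (true; false; T)
open import Data.Bool.Properties using (T?; T-irrelevant)
open import Data.Fin.Base using (Fin; zero; suc)
import Data.Fin.Properties as Fin
open import Data.List.Base
  using (List; []; _∷_; [_]; _++_; map; filter; concatMap; allFin; deduplicate; length)
import Data.List.Base as List
open import Data.List.Membership.Propositional using (_∈_; lose)
open import Data.List.Membership.Propositional.Properties
  using ( ∈-allFin; ∈-map⁺; ∈-++⁺ˡ; ∈-++⁺ʳ; ∈-concatMap⁺; ∈-cartesianProduct⁺; ∈-lookup
        ; ∈-map∘filter⁺; ∈-map∘filter⁻)
import Data.List.Relation.Unary.All as All
open import Data.List.Relation.Unary.AllPairs using (_∷_)
open import Data.List.Relation.Unary.Any as Any using (Any; here; there; index)
open import Data.List.Relation.Unary.Any.Properties using (lookup-index)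
open import Data.List.Relation.Unary.Enumerates.Setoid using (IsEnumeration)
import Data.List.Relation.Unary.Enumerates.Setoid.Properties as Enumerates
import Data.List.Relation.Unary.Unique.Setoid as UniqueSetoid
open import Data.List.Relation.Unary.Unique.DecSetoid.Properties using (deduplicate-!)
open import Data.Nat.Base using (ℕ; zero; suc; _+_; _∸_; _≤_; z≤n)
open import Data.Nat.Properties
  using (+-comm; +-identityʳ; m+n∸n≡m; m≤n+m; m∸n+n≡m; 0∸n≡0; 1+n≢0)
open import Data.Product.Base using (Σ; ∃; _×_; _,_; proj₁; proj₂; uncurry)
import Data.Product.Properties as Product
open import Data.Sum.Base using (_⊎_; inj₁; inj₂; [_,_]′)
open import Data.Sum.Relation.Binary.Pointwise as ⊎ using (_⊎ₛ_; inj₁; inj₂)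
open import Data.Unit.Base using (tt)
open import Data.Vec.Base using (Vec; lookup; tabulate; zipWith)
open import Data.Vec.Properties using (lookup-zipWith; lookup∘tabulate)
open import Data.Vec.Relation.Binary.Pointwise.Extensional using (ext; extensional⇒inductive)
import Data.Vec.Relation.Binary.Pointwise.Inductive as Pointwise
open import Function.Base using (_∘_; id)
open import Function.Bundles using (Bijection; Func; _⟨$⟩_)
open import Function.Definitions using (Congruent)
open import Relation.Binary.Bundles using (Setoid; DecSetoid)
open import Relation.Binary.Construct.Closure.ReflexiveTransitive using (Star; ε; _◅_; _◅◅_)
open import Relation.Binary.Core using (Rel)
open import Relation.Binary.Definitions using (Decidable; DecidableEquality)
open import Relation.Binary.PropositionalEquality
  using (_≡_; _≢_; refl; sym; trans; cong; cong₂; subst; setoid; module ≡-Reasoning)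
open import Relation.Nullary.Decidable using (Dec; yes; no; map′; _×-dec_; _⊎-dec_; ¬?)
open import Relation.Nullary.Negation using (¬_; contradiction)
open import Relation.Unary as Unary using (Pred)
open import Level using (0ℓ)

-- Reachability in finite graphs

module _ {A : Set} (E : Rel A 0ℓ) where

  -- Warshall: connection by a path all of whose inner vertices are in the list.
  Via : List A → Rel A 0ℓ
  Via []       x y = x ≡ y ⊎ E x y
  Via (k ∷ ks) x y = Via ks x y ⊎ (Via ks x k × Via ks k y)

  via? : DecidableEquality A → Decidable E → ∀ ks → Decidable (Via ks)
  via? _≟_ E? []       x y = (x ≟ y) ⊎-dec E? x y
  via? _≟_ E? (k ∷ ks) x y =
    via? _≟_ E? ks x y ⊎-dec (via? _≟_ E? ks x k ×-dec via? _≟_ E? ks k y)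

  via⇒star : ∀ ks {x y} → Via ks x y → Star E x y
  via⇒star []       (inj₁ refl)    = ε
  via⇒star []       (inj₂ e)       = e ◅ ε
  via⇒star (k ∷ ks) (inj₁ p)       = via⇒star ks p
  via⇒star (k ∷ ks) (inj₂ (p , q)) = via⇒star ks p ◅◅ via⇒star ks q

  via-base : ∀ ks {x y} → x ≡ y ⊎ E x y → Via ks x y
  via-base []       b = b
  via-base (k ∷ ks) b = inj₁ (via-base ks b)

  -- Loops are cut out. If `k` is the head, any detour from `k` back to `k` is dropped. If both
  -- halves pass through an earlier `j`, the loop from `j` over `k` to `j` is dropped.
  via-trans : ∀ ks {x k y} → k ∈ ks → Via ks x k → Via ks k y → Via ks x y
  via-trans (j ∷ ks) (here refl) p q = inj₂ ([ id , proj₁ ]′ p , [ id , proj₂ ]′ q)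
  via-trans (j ∷ ks) (there m) (inj₁ p) (inj₁ q) = inj₁ (via-trans ks m p q)
  via-trans (j ∷ ks) (there m) (inj₁ p) (inj₂ (q , r)) = inj₂ (via-trans ks m p q , r)
  via-trans (j ∷ ks) (there m) (inj₂ (p , q)) (inj₁ r) = inj₂ (p , via-trans ks m q r)
  via-trans (j ∷ ks) (there m) (inj₂ (p , _)) (inj₂ (_ , s)) = inj₂ (p , s)

  star⇒via : ∀ {ks} → (∀ x → x ∈ ks) → ∀ {x y} → Star E x y → Via ks x y
  star⇒via all∈ ε        = via-base _ (inj₁ refl)
  star⇒via all∈ (e ◅ es) =
    via-trans _ (all∈ _) (via-base _ (inj₂ e)) (star⇒via all∈ es)

  -- Paths in `Star E` have unbounded length, but `Via ks` is decided by recursion on `ks`, and the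
  -- two agree once `ks` lists all of `A`.
  star? : DecidableEquality A → Decidable E → ∀ {ks} → (∀ x → x ∈ ks) → Decidable (Star E)
  star? _≟_ E? {ks} all∈ x y = map′ (via⇒star ks) (star⇒via all∈) (via? _≟_ E? ks x y)

-- Finite setoids

module _ (DS : DecSetoid 0ℓ 0ℓ) where
  private module DS = DecSetoid DS
  open DS using (_≈_) renaming (Carrier to A; setoid to S)
  open UniqueSetoid S using (Unique)

  lookup-injective : ∀ {xs} → Unique xs → ∀ i j → List.lookup xs i ≈ List.lookup xs j → i ≡ j
  lookup-injective {_ ∷ _}  _          zero    zero    _  = refl
  lookup-injective {_ ∷ xs} (x≉ ∷ _)   zero    (suc j) eq =
    contradiction eq (All.lookup x≉ (∈-lookup j))
  lookup-injective {_ ∷ xs} (x≉ ∷ _)   (suc i) zero    eq =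
    contradiction (DS.sym eq) (All.lookup x≉ (∈-lookup i))
  lookup-injective {_ ∷ _}  (_ ∷ uniq) (suc i) (suc j) eq =
    cong suc (lookup-injective uniq i j eq)

  -- After deduplication up to `_≈_`, each class occupies exactly one position of the list, and that
  -- position numbers the class.
  finite-bijection : ∀ {xs} → IsEnumeration S xs → ∃ λ n → Bijection S (setoid (Fin n))
  finite-bijection {xs} enum = length ys , record
    { to        = position
    ; cong      = λ {x} {y} x≈y → lookup-injective uniq _ _
                    (DS.trans (DS.sym (at-position x)) (DS.trans x≈y (at-position y)))
    ; bijective =
        (λ {x} {y} eq → DS.trans (at-position x)
          (DS.trans (DS.reflexive (cong (List.lookup ys) eq)) (DS.sym (at-position y))))
      , λ k → List.lookup ys k , λ {z} z≈ →
          lookup-injective uniq _ _ (DS.trans (DS.sym (at-position z)) z≈)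
    }
    where
    ys : List A
    ys = deduplicate DS._≟_ xs

    uniq : Unique ys
    uniq = deduplicate-! DS xs

    enum′ : IsEnumeration S ys
    enum′ = Enumerates.deduplicate⁺ DS enum

    position : A → Fin (length ys)
    position x = index (enum′ x)

    at-position : ∀ x → x ≈ List.lookup ys (position x)
    at-position x = lookup-index (enum′ x)

allΣ : ∀ {n} {B : Fin n → Set} → (∀ i → List (B i)) → List (Σ (Fin n) B)
allΣ xs = concatMap (λ i → map (i ,_) (xs i)) (allFin _)

∈-allΣ : ∀ {n} {B : Fin n → Set} {xs : ∀ i → List (B i)} {i b} → b ∈ xs i → (i , b) ∈ allΣ xs
∈-allΣ {xs = xs} {i} b∈ =
  ∈-concatMap⁺ (λ i → map (i ,_) (xs i)) (lose (∈-allFin i) (∈-map⁺ (i ,_) b∈))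

allT : ∀ b → List (T b)
allT true  = [ tt ]
allT false = []

∈-allT : ∀ {b} (t : T b) → t ∈ allT b
∈-allT {true} tt = here refl

module _ {A : Set} {P : Pred A 0ℓ} (P? : Unary.Decidable P) where

  witnesses : List A → List (Σ A P)
  witnesses []       = []
  witnesses (x ∷ xs) with P? x
  ... | yes px = (x , px) ∷ witnesses xs
  ... | no  _  = witnesses xs

  -- Only first components are compared: the listed proof of `P x` may differ from the given one,
  -- and location dishes ignore it anyway.
  ∈-witnesses : ∀ {x xs} → x ∈ xs → P x → Any (λ w → x ≡ proj₁ w) (witnesses xs)
  ∈-witnesses {x} (here refl) px with P? x
  ... | yes _  = here refl
  ... | no ¬px = contradiction px ¬px
  ∈-witnesses {xs = y ∷ _} (there x∈) px with P? y
  ... | yes _ = there (∈-witnesses x∈ px)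
  ... | no  _ = ∈-witnesses x∈ px

-- Indicators

⟦_⟧ : ∀ {A : Set} → Dec A → ℕ
⟦ yes _ ⟧ = 1
⟦ no  _ ⟧ = 0

⟦⟧-yes : ∀ {A : Set} (A? : Dec A) → A → ⟦ A? ⟧ ≡ 1
⟦⟧-yes (yes _) _ = refl
⟦⟧-yes (no ¬a) a = contradiction a ¬a

⟦⟧-no : ∀ {A : Set} (A? : Dec A) → ¬ A → ⟦ A? ⟧ ≡ 0
⟦⟧-no (yes a) ¬a = contradiction a ¬a
⟦⟧-no (no _)  _  = refl

⟦⟧-cong : ∀ {A B : Set} (A? : Dec A) (B? : Dec B) → (A → B) → (B → A) → ⟦ A? ⟧ ≡ ⟦ B? ⟧
⟦⟧-cong A? (yes b) _ g = ⟦⟧-yes A? (g b)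
⟦⟧-cong A? (no ¬b) f _ = ⟦⟧-no A? (¬b ∘ f)

⟦⟧-positive : ∀ {A : Set} (A? : Dec A) → 1 ≤ ⟦ A? ⟧ → A
⟦⟧-positive (yes a) _ = a

-- The net of a system

module _ (G : System) where
  open System G
  open Configuration
  open Gadget using (#states; #locations; Vertex; vertices; edge)
  private
    module L = Setoid (Location G)

    P : Set
    P = Port gadget destroyer

    States : Set
    States = ∀ i → Fin (#states (gadget i))

  -- Deciding when ports are identified

  infix 4 _~′_
  _~′_ : P → P → Set
  _~′_ = _~_ G

  _≟ₚ_ : DecidableEquality P
  source  ≟ₚ source  = yes refl
  source  ≟ₚ sink _  = no λ ()
  source  ≟ₚ at _ _  = no λ ()
  sink _  ≟ₚ source  = no λ ()
  sink d  ≟ₚ sink d′ = yes (cong sink (T-irrelevant d d′))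
  sink _  ≟ₚ at _ _  = no λ ()
  at _ _  ≟ₚ source  = no λ ()
  at _ _  ≟ₚ sink _  = no λ ()
  at i a  ≟ₚ at j b  =
    map′ (cong (uncurry at)) (λ { refl → refl }) (Product.≡-dec Fin._≟_ Fin._≟_ (i , a) (j , b))

  ports : List P
  ports = source ∷ map sink (allT destroyer) ++ map (uncurry at) (allΣ λ _ → allFin _)

  ∈-ports : ∀ p → p ∈ ports
  ∈-ports source   = here refl
  ∈-ports (sink d) = there (∈-++⁺ˡ (∈-map⁺ sink (∈-allT d)))
  ∈-ports (at i a) =
    there (∈-++⁺ʳ (map sink (allT destroyer))
      (∈-map⁺ (uncurry at) (∈-allΣ {xs = λ _ → allFin _} (∈-allFin a))))

  infix 4 _~?_
  abstract
    _~?_ : Decidable _~′_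
    _~?_ = star? _ _≟ₚ_ (λ p q → T? (connected p q)) ∈-ports

  atSource? : Unary.Decidable (AtSource G)
  atSource? p = p ~? source

  atSink? : Unary.Decidable (AtSink G)
  atSink? p with T? destroyer
  ... | no ¬d = no λ (d , _) → ¬d d
  -- The two proofs of `T destroyer` name the same sink, so the path can be moved to the chosen `d`.
  ... | yes d = map′ (d ,_) (λ (d′ , p~) → subst (λ e → p ~′ sink e) (T-irrelevant d′ d) p~)
                  (p ~? sink d)

  AtSink-resp : ∀ {p q} → p ~′ q → AtSink G q → AtSink G p
  AtSink-resp p~q (d , q~) = d , L.trans p~q q~

  -- Dishes and vectors over them

  private
    Dish : Setoid 0ℓ 0ℓ
    Dish = D-STATE G ⊎ₛ D-LOCT G

    module Dish = Setoid Dish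

    GadgetState : Set
    GadgetState = Setoid.Carrier (D-STATE G)

  _≟ₛ_ : DecidableEquality GadgetState
  _≟ₛ_ = Product.≡-dec Fin._≟_ Fin._≟_

  private
    decDish : DecSetoid 0ℓ 0ℓ
    decDish = record
      { isDecEquivalence = record
          { isEquivalence = Dish.isEquivalence
          ; _≟_           = ⊎.⊎-decidable _≟ₛ_ (λ x y → proj₁ x ~? proj₁ y)
          }
      }

  net-location? : Unary.Decidable (λ p → ¬ AtSource G p × ¬ AtSink G p)
  net-location? p = ¬? (atSource? p) ×-dec ¬? (atSink? p)

  abstract
    finite-dishes : ∃ λ n → Bijection Dish (setoid (Fin n))
    -- Identified ports are listed separately here; the deduplication in `finite-bijection` merges
    -- them into one dish.
    finite-dishes = finite-bijection decDish
      (Enumerates.++⁺ (D-STATE G) (D-LOCT G)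
        {xs = allΣ λ _ → allFin _} {ys = witnesses net-location? ports}
        (λ (i , Q) → ∈-allΣ {xs = λ _ → allFin _} (∈-allFin Q))
        (λ (p , ok) → Any.map L.reflexive (∈-witnesses net-location? (∈-ports p) ok)))

  private module B = Bijection (proj₂ finite-dishes)

  private
    Vector : Set
    Vector = Vec ℕ (proj₁ finite-dishes)

  vector : (Dish.Carrier → ℕ) → Vector
  vector f = tabulate (f ∘ proj₁ ∘ B.strictlySurjective)

  -- The preimage of an index is only some dish of the right class, hence the congruence hypothesis
  -- on `f`.
  lookup-vector : ∀ {f} → Congruent Dish._≈_ _≡_ f → ∀ x → lookup (vector f) (B.to x) ≡ f x
  lookup-vector f-cong x = trans (lookup∘tabulate _ (B.to x))
    (f-cong (B.injective (proj₂ (B.strictlySurjective (B.to x)))))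

  -- Location dishes never belong to the source or the sink, so the robot part of
  -- the weight vanishes when p is there.
  weight : GadgetState → P → Dish.Carrier → ℕ
  weight s p (inj₁ s′)      = ⟦ s ≟ₛ s′ ⟧
  weight s p (inj₂ (q , _)) = ⟦ q ~? p ⟧

  weight-cong : ∀ s p → Congruent Dish._≈_ _≡_ (weight s p)
  weight-cong s p (inj₁ refl)  = refl
  weight-cong s p (inj₂ q~q′) = ⟦⟧-cong (_ ~? p) (_ ~? p) (L.trans (L.sym q~q′)) (L.trans q~q′)

  -- Rules

  private
    Transition : Set
    Transition = Σ (Fin #gadgets) λ i → Vertex (gadget i) × Vertex (gadget i)

  -- A rule starting at the sink would demand no robot token and could fire although no robot is
  -- ever there; the second condition keeps soundness.
  Enabled : Transition → Set
  Enabled (i , v@(_ , a) , v′) = T (edge (gadget i) v v′) × ¬ AtSink G (at i a)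

  enabled? : Unary.Decidable Enabled
  enabled? _ = T? _ ×-dec ¬? (atSink? _)

  transitions : List Transition
  transitions = allΣ λ i → List.cartesianProduct (vertices (gadget i)) (vertices (gadget i))

  ∈-transitions : ∀ τ → τ ∈ transitions
  ∈-transitions (i , (Q , a) , (Q′ , b)) =
    ∈-allΣ {xs = λ i → List.cartesianProduct (vertices (gadget i)) (vertices (gadget i))}
      (∈-cartesianProduct⁺ (∈-cartesianProduct⁺ (∈-allFin Q) (∈-allFin a))
                           (∈-cartesianProduct⁺ (∈-allFin Q′) (∈-allFin b)))

  rule : Transition → Vector × Vector
  rule (i , (Q , a) , (Q′ , b)) = vector (weight (i , Q) (at i a)) , vector (weight (i , Q′) (at i b))

  net : PetriNet
  net = record
    { #dishes = proj₁ finite-dishes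
    ; rules   = map rule (filter enabled? transitions)
    }

  open PetriNet net using (Fires; fire; REACH-P)

  -- Token counts of configurations

  content : States → Robots G → Dish.Carrier → ℕ
  content Γ l (inj₁ (i , Q)) = ⟦ Q Fin.≟ Γ i ⟧
  content Γ l (inj₂ (q , _)) = l ⟨$⟩ q

  Holds : Vector → (Dish.Carrier → ℕ) → Set
  Holds t f = ∀ x → lookup t (B.to x) ≡ f x

  private
    Rep : Vector → Configuration G → Set
    Rep = Represents G net (proj₂ finite-dishes)

  -- The indicator in `content` merges `current` and `others`, so representation becomes one
  -- equation over all dishes and firing becomes arithmetic.
  represents⇒holds : ∀ {t c} → Rep t c → Holds t (content (Γ c) (l c))
  represents⇒holds {c = c} r (inj₁ (i , Q)) with Q Fin.≟ Γ c i
  ... | yes refl = Represents.current r i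
  ... | no  Q≢   = Represents.others r i Q Q≢
  represents⇒holds r (inj₂ x) = Represents.location r x

  holds⇒represents : ∀ {t c} → Holds t (content (Γ c) (l c)) → Rep t c
  holds⇒represents {c = c} h = record
    { current  = λ i → trans (h (inj₁ (i , Γ c i))) (⟦⟧-yes (Γ c i Fin.≟ Γ c i) refl)
    ; others   = λ i Q Q≢ → trans (h (inj₁ (i , Q))) (⟦⟧-no (Q Fin.≟ Γ c i) Q≢)
    ; location = h ∘ inj₂
    }

  -- The content of a configuration apart from gadget i and the moving robot.
  remainder : Fin #gadgets → States → Robots G → Dish.Carrier → ℕ
  remainder i Γ rest (inj₁ (j , R)) with j Fin.≟ i
  ... | yes _ = 0
  ... | no  _ = ⟦ R Fin.≟ Γ j ⟧
  remainder i Γ rest (inj₂ (q , _)) = rest ⟨$⟩ q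

  -- Applied before and after a traversal with the same remainder, so that only the weight changes.
  -- The robot equation is asked only off the sink, where deletion cannot disturb it.
  content-split : ∀ i p {Γ Γ₀ : States} {l rest : Robots G} →
    (∀ j → j ≢ i → Γ j ≡ Γ₀ j) →
    (∀ {q} → ¬ AtSink G q → l ⟨$⟩ q ≡ (rest ⟨$⟩ q) + ⟦ q ~? p ⟧) →
    ∀ x → content Γ l x ≡ remainder i Γ₀ rest x + weight (i , Γ i) p x
  content-split i p {Γ} {Γ₀} same robots (inj₁ (j , R)) with j Fin.≟ i
  ... | yes refl = ⟦⟧-cong (R Fin.≟ Γ i) ((i , Γ i) ≟ₛ (i , R)) (λ { refl → refl }) (λ { refl → refl })
  ... | no  j≢i  = trans (cong (λ Q → ⟦ R Fin.≟ Q ⟧) (same j j≢i))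
    (trans (sym (+-identityʳ _))
      (cong (⟦ R Fin.≟ Γ₀ j ⟧ +_) (sym (⟦⟧-no ((i , Γ i) ≟ₛ (j , R)) λ { refl → j≢i refl }))))
  content-split i p same robots (inj₂ (q , _ , ¬sink)) = robots ¬sink

  -- Robot counts under departure and arrival

  oneMore⇒+ : ∀ {p l l′} → OneMore G p l l′ → ∀ q → l′ ⟨$⟩ q ≡ (l ⟨$⟩ q) + ⟦ q ~? p ⟧
  oneMore⇒+ {p} {l} om q with q ~? p
  ... | yes q~ = trans (OneMore.here om q~) (+-comm 1 (l ⟨$⟩ q))
  ... | no ¬q~ = trans (OneMore.elsewhere om ¬q~) (sym (+-identityʳ _))

  -- Deletion fits the same formula: if `p` is at the sink and `q` is not, they are not identified
  -- and the indicator is 0.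
  arrives⇒+ : ∀ {p l l′} → Arrives G p l l′ →
    ∀ {q} → ¬ AtSink G q → l′ ⟨$⟩ q ≡ (l ⟨$⟩ q) + ⟦ q ~? p ⟧
  arrives⇒+ (stays _ om) _ = oneMore⇒+ om _
  arrives⇒+ {p} (deleted p-sink same) {q} ¬sink =
    trans (same q) (trans (sym (+-identityʳ _))
      (cong (_ +_) (sym (⟦⟧-no (q ~? p) λ q~p → ¬sink (AtSink-resp q~p p-sink)))))

  add remove arrive : P → Robots G → Robots G
  add p l = record
    { to   = λ q → (l ⟨$⟩ q) + ⟦ q ~? p ⟧
    ; cong = λ q~q′ → cong₂ _+_ (Func.cong l q~q′)
        (⟦⟧-cong (_ ~? p) (_ ~? p) (L.trans (L.sym q~q′)) (L.trans q~q′))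
    }
  remove p l = record
    { to   = λ q → (l ⟨$⟩ q) ∸ ⟦ q ~? p ⟧
    ; cong = λ q~q′ → cong₂ _∸_ (Func.cong l q~q′)
        (⟦⟧-cong (_ ~? p) (_ ~? p) (L.trans (L.sym q~q′)) (L.trans q~q′))
    }
  arrive p l with atSink? p
  ... | yes _ = l
  ... | no  _ = add p l

  +⇒oneMore : ∀ {p l l′} → (∀ q → l′ ⟨$⟩ q ≡ (l ⟨$⟩ q) + ⟦ q ~? p ⟧) → OneMore G p l l′
  +⇒oneMore {p} {l} eq = record
    { here      = λ {q} q~ →
        trans (eq q) (trans (cong ((l ⟨$⟩ q) +_) (⟦⟧-yes (q ~? p) q~)) (+-comm _ 1))
    ; elsewhere = λ {q} ¬q~ →
        trans (eq q) (trans (cong ((l ⟨$⟩ q) +_) (⟦⟧-no (q ~? p) ¬q~)) (+-identityʳ _))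
    }

  -- A robot at `p` keeps the truncated subtraction in `remove` from losing anything.
  remove-oneMore : ∀ {p l} → 1 ≤ l ⟨$⟩ p → OneMore G p (remove p l) l
  remove-oneMore {p} {l} 1≤ = +⇒oneMore λ q → sym (m∸n+n≡m (bound q))
    where
    bound : ∀ q → ⟦ q ~? p ⟧ ≤ l ⟨$⟩ q
    bound q with q ~? p
    ... | yes q~ = subst (1 ≤_) (Func.cong l (L.sym q~)) 1≤
    ... | no  _  = z≤n

  arrive-arrives : ∀ p l → Arrives G p l (arrive p l)
  arrive-arrives p l with atSink? p
  ... | yes s = deleted s λ _ → refl
  ... | no ¬s = stays ¬s (+⇒oneMore λ _ → refl)

  NoneAtSink : Robots G → Set
  NoneAtSink l = ∀ {q} → AtSink G q → l ⟨$⟩ q ≡ 0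

  remove-noneAtSink : ∀ p l → NoneAtSink l → NoneAtSink (remove p l)
  remove-noneAtSink p l none {q} s = trans (cong (_∸ ⟦ q ~? p ⟧) (none s)) (0∸n≡0 ⟦ q ~? p ⟧)

  arrive-noneAtSink : ∀ p l → NoneAtSink l → NoneAtSink (arrive p l)
  arrive-noneAtSink p l none {q} s with atSink? p
  ... | yes _ = none s
  ... | no ¬s = cong₂ _+_ (none s)
    (⟦⟧-no (q ~? p) λ q~p → ¬s (AtSink-resp (L.sym q~p) s))

  -- Robots at the source are invisible to the net, so one can be supplied on demand.
  supply : ∀ c p → ¬ AtSink G p → (¬ AtSource G p → 1 ≤ l c ⟨$⟩ p) →
    ∃ λ c₁ → REACH-G G c c₁ × (∀ i → Γ c₁ i ≡ Γ c i) ×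
      (∀ x → content (Γ c₁) (l c₁) x ≡ content (Γ c) (l c) x) × 1 ≤ l c₁ ⟨$⟩ p
  supply c p ¬sink occupied with atSource? p
  ... | no ¬src = c , ε , (λ _ → refl) , (λ _ → refl) , occupied ¬src
  ... | yes src = c₁ , spawn (λ _ → refl) arrival ◅ ε , (λ _ → refl) , same , positive
    where
    c₁ : Configuration G
    c₁ = record
      { Γ          = Γ c
      ; l          = arrive source (l c)
      ; sink-empty = arrive-noneAtSink source (l c) (sink-empty c)
      }

    arrival : Arrives G source (l c) (l c₁)
    arrival = arrive-arrives source (l c)

    same : ∀ x → content (Γ c) (l c₁) x ≡ content (Γ c) (l c) x
    same (inj₁ _) = refl
    same (inj₂ (q , ¬q-src , ¬q-sink)) = trans (arrives⇒+ arrival ¬q-sink)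
      (trans (cong ((l c ⟨$⟩ q) +_) (⟦⟧-no (q ~? source) ¬q-src)) (+-identityʳ _))

    positive : 1 ≤ l c₁ ⟨$⟩ p
    -- Since `p` is off the sink, the spawned robot survives its arrival.
    positive = subst (1 ≤_)
      (sym (trans (arrives⇒+ arrival ¬sink) (cong ((l c ⟨$⟩ p) +_) (⟦⟧-yes (p ~? source) src))))
      (m≤n+m 1 (l c ⟨$⟩ p))

  -- State change and the arithmetic of a firing

  replace : ∀ i → Fin (#states (gadget i)) → States → States
  replace i Q Γ j with j Fin.≟ i
  ... | yes refl = Q
  ... | no  _    = Γ j

  replace-at : ∀ i Q Γ → replace i Q Γ i ≡ Q
  replace-at i Q Γ with i Fin.≟ i
  ... | yes refl = refl
  ... | no  i≢i  = contradiction refl i≢i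

  replace-elsewhere : ∀ i Q Γ j → j ≢ i → replace i Q Γ j ≡ Γ j
  replace-elsewhere i Q Γ j j≢i with j Fin.≟ i
  ... | yes j≡i = contradiction j≡i j≢i
  ... | no  _   = refl

  -- The consumed vector is itself a summand of the contents, so subtraction cancels it exactly and
  -- leaves `r`.
  holds-after-firing : ∀ t (r : Dish.Carrier → ℕ) {s p s′ p′} → Holds t (λ x → r x + weight s p x) →
    Holds (zipWith _+_ (zipWith _∸_ t (vector (weight s p))) (vector (weight s′ p′)))
          (λ x → r x + weight s′ p′ x)
  holds-after-firing t r {s} {p} {s′} {p′} h x = begin
    lookup (zipWith _+_ (zipWith _∸_ t u) v) (B.to x)
      ≡⟨ lookup-zipWith _+_ (B.to x) (zipWith _∸_ t u) v ⟩
    lookup (zipWith _∸_ t u) (B.to x) + lookup v (B.to x)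
      ≡⟨ cong₂ _+_ (lookup-zipWith _∸_ (B.to x) t u) (lookup-vector (weight-cong s′ p′) x) ⟩
    lookup t (B.to x) ∸ lookup u (B.to x) + weight s′ p′ x
      ≡⟨ cong (_+ weight s′ p′ x) (cong₂ _∸_ (h x) (lookup-vector (weight-cong s p) x)) ⟩
    r x + weight s p x ∸ weight s p x + weight s′ p′ x
      ≡⟨ cong (_+ weight s′ p′ x) (m+n∸n≡m (r x) (weight s p x)) ⟩
    r x + weight s′ p′ x ∎
    where
    open ≡-Reasoning
    u v : Vector
    u = vector (weight s p)
    v = vector (weight s′ p′)

  vector-≤ : ∀ t (r : Dish.Carrier → ℕ) {s p} → Holds t (λ x → r x + weight s p x) →
    Pointwise.Pointwise _≤_ (vector (weight s p)) t
  vector-≤ t r {s} {p} h = extensional⇒inductive (ext bound)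
    where
    bound : ∀ k → lookup (vector (weight s p)) k ≤ lookup t k
    bound k with x , refl ← B.strictlySurjective k
      rewrite lookup-vector (weight-cong s p) x | h x = m≤n+m _ (r x)

  -- Lets soundness read off from the applicability of a rule which state the gadget is in and that
  -- a robot is present.
  ≤-weight : ∀ {t f s p} → Holds t f → Pointwise.Pointwise _≤_ (vector (weight s p)) t →
    ∀ x → weight s p x ≤ f x
  ≤-weight {t} {f} {s} {p} h u≤t x =
    subst (_≤ f x) (lookup-vector (weight-cong s p) x)
      (subst (lookup (vector (weight s p)) (B.to x) ≤_) (h x) (Pointwise.lookup u≤t (B.to x)))

  -- Simulation in both directions

  step-complete : ∀ {c c′ t} → Holds t (content (Γ c) (l c)) → Step G c c′ →
    ∃ λ t′ → REACH-P t t′ × Holds t′ (content (Γ c′) (l c′))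
  step-complete {c} {c′} {t} h (spawn sameΓ arr) = t , ε , h′
    where
    h′ : Holds t (content (Γ c′) (l c′))
    h′ x@(inj₁ (i , Q)) = trans (h x) (cong (λ R → ⟦ Q Fin.≟ R ⟧) (sym (sameΓ i)))
    h′ x@(inj₂ (q , ¬src , ¬sink)) = trans (h x) (sym (trans (arrives⇒+ arr ¬sink)
      (trans (cong ((l c ⟨$⟩ q) +_) (⟦⟧-no (q ~? source) ¬src)) (+-identityʳ _))))
  step-complete {c} {c′} {t} h (traverse i a b rest e sameΓ leaves arr) =
    _ , fire rule∈ (vector-≤ t r h₁) ◅ ε , λ x →
      trans (holds-after-firing t r h₁ x) (sym (content-split i (at i b) sameΓ (arrives⇒+ arr) x))
    where
    r : Dish.Carrier → ℕ
    r = remainder i (Γ c) rest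

    h₁ : Holds t λ x → r x + weight (i , Γ c i) (at i a) x
    h₁ x = trans (h x)
      (content-split i (at i a) (λ _ _ → refl) (λ {q} _ → oneMore⇒+ leaves q) x)

    ¬sink : ¬ AtSink G (at i a)
    -- The departing robot makes the count at its start positive, against `sink-empty`.
    ¬sink s = 1+n≢0 (trans (sym (OneMore.here leaves L.refl)) (sink-empty c s))

    rule∈ : rule (i , (Γ c i , a) , (Γ c′ i , b)) ∈ PetriNet.rules net
    rule∈ = ∈-map∘filter⁺ rule enabled? {f = rule} {xs = transitions}
      (_ , ∈-transitions _ , refl , e , ¬sink)

  fires-sound : ∀ {c t t′} → Holds t (content (Γ c) (l c)) → Fires t t′ →
    ∃ λ c′ → REACH-G G c c′ × Holds t′ (content (Γ c′) (l c′))
  fires-sound {c} {t} h (fire uv∈ u≤t)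
    with (i , (Q , a) , (Q′ , b)) , _ , refl , e , ¬sink
           ← ∈-map∘filter⁻ rule enabled? {xs = transitions} uv∈
    -- The rule takes a token from the dish of `Q`, which is nonempty only if `Q` is the current
    -- state.
    with refl ← ⟦⟧-positive (Q Fin.≟ Γ c i)
           (subst (_≤ ⟦ Q Fin.≟ Γ c i ⟧) (⟦⟧-yes ((i , Q) ≟ₛ (i , Q)) refl)
             (≤-weight h u≤t (inj₁ (i , Q))))
    -- Off the source, `at i a` has a dish, and the token consumed there witnesses a robot; at the
    -- source, `supply` spawns one.
    with c₁ , reach , sameΓ , same , positive ← supply c (at i a) ¬sink
           (λ ¬src → subst (_≤ l c ⟨$⟩ at i a) (⟦⟧-yes (at i a ~? at i a) ε)
             (≤-weight h u≤t (inj₂ (at i a , ¬src , ¬sink)))) =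
    c′ , reach ◅◅ (move ◅ ε) , λ x →
      trans (holds-after-firing t r h₁ x)
        (trans (cong (λ R → r x + weight (i , R) (at i b) x)
                     (sym (replace-at i Q′ (Γ c))))
          (sym (content-split i (at i b) (replace-elsewhere i Q′ (Γ c)) (arrives⇒+ arrival) x)))
    where
    rest : Robots G
    rest = remove (at i a) (l c₁)

    c′ : Configuration G
    c′ = record
      { Γ          = replace i Q′ (Γ c)
      ; l          = arrive (at i b) rest
      ; sink-empty = arrive-noneAtSink (at i b) rest
                       (remove-noneAtSink (at i a) (l c₁) (sink-empty c₁))
      }

    leaves : OneMore G (at i a) rest (l c₁)
    leaves = remove-oneMore positive

    arrival : Arrives G (at i b) rest (l c′)
    arrival = arrive-arrives (at i b) rest

    move : Step G c₁ c′
    move = traverse i a b rest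
      (subst T (cong₂ (λ R R′ → edge (gadget i) (R , a) (R′ , b))
                 (sym (sameΓ i)) (sym (replace-at i Q′ (Γ c)))) e)
      (λ j j≢i → trans (replace-elsewhere i Q′ (Γ c) j j≢i) (sym (sameΓ j)))
      leaves arrival

    r : Dish.Carrier → ℕ
    r = remainder i (Γ c) rest

    h₁ : Holds t λ x → r x + weight (i , Γ c i) (at i a) x
    -- `t` describes `c₁` as well as `c`, since `same` shows that supplying a robot leaves the
    -- contents of all dishes fixed.
    h₁ x = trans (h x) (trans (sym (same x))
      (trans (content-split i (at i a) (λ j _ → sameΓ j) (λ {q} _ → oneMore⇒+ leaves q) x)
        (cong (λ R → r x + weight (i , R) (at i a) x) (sameΓ i))))

  complete : ∀ {c c′ t} → Holds t (content (Γ c) (l c)) → REACH-G G c c′ →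
    ∃ λ t′ → REACH-P t t′ × Holds t′ (content (Γ c′) (l c′))
  complete h ε = _ , ε , h
  complete h (s ◅ ss) =
    let _ , r , h₁ = step-complete h s ; t′ , rs , h′ = complete h₁ ss in t′ , r ◅◅ rs , h′

  sound : ∀ {c t t′} → Holds t (content (Γ c) (l c)) → REACH-P t t′ →
    ∃ λ c′ → REACH-G G c c′ × Holds t′ (content (Γ c′) (l c′))
  sound h ε = _ , ε , h
  sound h (f ◅ fs) =
    let _ , r , h₁ = fires-sound h f ; c′ , rs , h′ = sound h₁ fs in c′ , r ◅◅ rs , h′

  net-simulates : Simulates net G
  net-simulates = proj₂ finite-dishes , record
    { complete = λ c t r c′ reach →
        let t′ , reach′ , h = complete (represents⇒holds r) reach
        in  t′ , reach′ , holds⇒represents h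
    ; sound    = λ c t r t′ reach →
        let c′ , reach′ , h = sound (represents⇒holds r) reach
        in  c′ , reach′ , holds⇒represents h
    }

lemma4p3 : ∀ {ℓ} (S : Pred Gadget ℓ) → (∀ g → S g → Deterministic g) →
    (G : System) → ConsistsOf S G →
    ∃ λ (N : PetriNet) → Simulates N G
lemma4p3 _ _ G _ = net G , net-simulates G
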